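{- Let $H$ be a graph. The class of $H$-free bipartite graphs is ivc-bounded if and only if $H$ is (isomorphic to) an induced subgraph of $K_{1,r}+rP_1$ or of $K_{1,r}^+$ for some $r\geq 1$.
   Context: Graphs are finite, simple and undirected. A graph is $H$-free if it has no induced subgraph isomorphic to $H$. $G+H$ is the disjoint union and $rG$ is the disjoint union of $r$ copies of $G$. $P_n$ is the path on $n$ vertices. $K_{1,r}$ is the star with $r$ leaves, and $K_{1,r}^+$ ($r\ge 1$) is the graph obtained from $K_{1,r}$ by subdividing one edge once. A vertex cover of $G$ is a set $S\subseteq V(G)$ such that $G-S$ has no edges. A graph has an independent vertex cover (a vertex cover that is an independent set) if and only if it is bipartite. For a bipartite graph $G$, $\mathrm{vc}(G)$ is the minimum size of a vertex cover and $\mathrm{ivc}(G)$ is the minimum size of an independent vertex cover. A class $\mathcal X$ of bipartite graphs is ivc-bounded if there is a function $f:\mathbb{Z}_{\geq 0}\to\mathbb{Z}_{\geq 0}$ such that $\mathrm{ivc}(G)\leq f(\mathrm{vc}(G))$ for every $G\in\mathcal X$. -}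

module Defs where

open import Data.Bool.Base using (Bool; true; false)
open import Data.Empty using (⊥)
open import Data.Fin.Base using (Fin; zero; suc; toℕ; fromℕ<; splitAt)
open import Data.Fin.Properties using (_≟_; all?)
open import Data.Fin.Subset using (Subset; ∣_∣; _∈_; _∉_; ⊤)
open import Data.Fin.Subset.Properties using (_∈?_; anySubset?; ∈⊤)
open import Data.Nat.Base using (ℕ; zero; suc; _+_; _≤_; _<_; _≥_; s≤s)
import Data.Nat.Properties as ℕ
open import Data.Product.Base using (∃; ∃-syntax; Σ-syntax; _×_; _,_; proj₁; proj₂)
open import Data.Sum.Base using (_⊎_; inj₁; inj₂; swap)
open import Data.Sum.Relation.Binary.Pointwise as Pw using (Pointwise)
open import Data.Unit.Base using (tt) renaming (⊤ to Unit)
open import Data.Vec.Base using (tabulate)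
open import Data.Vec.Properties using (lookup∘tabulate; []=⇒lookup; lookup⇒[]=)
open import Function.Bundles using (_⇔_)
open import Function.Definitions using (Injective)
open import Level using (0ℓ)
open import Relation.Binary.Core using (Rel)
open import Relation.Binary.Definitions using (Decidable; Symmetric)
open import Relation.Binary.PropositionalEquality
  using (_≡_; _≢_; refl; sym; trans)
open import Relation.Nullary using (¬_; yes; no; contradiction)
open import Relation.Nullary.Decidable using (_×-dec_; _⊎-dec_; _→-dec_; ¬?)
open import Relation.Unary using (Pred)
import Relation.Unary as U

record Graph : Set₁ where
  field
    order  : ℕ
    Adj    : Rel (Fin order) 0ℓ
    Adj?   : Decidable Adj
    symm   : Symmetric Adj
    irrefl : ∀ {v} → ¬ Adj v v

  Vertex : Set
  Vertex = Fin order

open Graph using (order; Adj; Vertex)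

-- H is isomorphic to an induced subgraph of G; the subgraph in question is the
-- one induced by the image of the map.
_⊑_ : Graph → Graph → Set
H ⊑ G = Σ[ f ∈ (Vertex H → Vertex G) ]
          Injective _≡_ _≡_ f × (∀ u v → Adj H u v ⇔ Adj G (f u) (f v))

_IsFree : Graph → Pred Graph 0ℓ
(H IsFree) G = ¬ (H ⊑ G)

null : Graph
null = record
  { order = 0 ; Adj = λ _ _ → ⊥ ; Adj? = λ () ; symm = λ () ; irrefl = λ () }

infixr 6 _⊕_
infixr 7 _·_
infix  4 _⊑_

_⊕_ : Graph → Graph → Graph
G ⊕ H = record
  { order  = order G + order H
  ; Adj    = λ u v → Pointwise (Adj G) (Adj H) (split u) (split v)
  ; Adj?   = λ u v → Pw.⊎-decidable (Graph.Adj? G) (Graph.Adj? H) (split u) (split v)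
  ; symm   = Pw.⊎-symmetric (Graph.symm G) (Graph.symm H)
  ; irrefl = λ {v} → irr (split v)
  }
  where
  split : Fin (order G + order H) → Vertex G ⊎ Vertex H
  split = splitAt (order G)

  irr : ∀ x → ¬ Pointwise (Adj G) (Adj H) x x
  irr (inj₁ _) (Pw.inj₁ a) = Graph.irrefl G a
  irr (inj₂ _) (Pw.inj₂ a) = Graph.irrefl H a

_·_ : ℕ → Graph → Graph
zero  · G = null
suc r · G = G ⊕ r · G

path : ℕ → Graph
path n = record
  { order  = n
  ; Adj    = λ i j → toℕ j ≡ suc (toℕ i) ⊎ toℕ i ≡ suc (toℕ j)
  ; Adj?   = λ i j → (toℕ j ℕ.≟ suc (toℕ i)) ⊎-dec (toℕ i ℕ.≟ suc (toℕ j))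
  ; symm   = swap
  ; irrefl = λ { (inj₁ e) → ℕ.1+n≢n (sym e) ; (inj₂ e) → ℕ.1+n≢n (sym e) }
  }

-- K₁,ᵣ, with centre zero.
star : ℕ → Graph
star r = record
  { order  = suc r
  ; Adj    = adj
  ; Adj?   = adj?
  ; symm   = λ {i} {j} → adj-sym i j
  ; irrefl = λ {i} → adj-irr i
  }
  where
  adj : Rel (Fin (suc r)) 0ℓ
  adj zero    zero    = ⊥
  adj zero    (suc _) = Unit
  adj (suc _) zero    = Unit
  adj (suc _) (suc _) = ⊥

  adj? : Decidable adj
  adj? zero    zero    = no λ ()
  adj? zero    (suc _) = yes tt
  adj? (suc _) zero    = yes tt
  adj? (suc _) (suc _) = no λ ()

  adj-sym : ∀ i j → adj i j → adj j i
  adj-sym zero    (suc _) _ = tt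
  adj-sym (suc _) zero    _ = tt

  adj-irr : ∀ i → ¬ adj i i
  adj-irr zero    ()
  adj-irr (suc _) ()

-- The new vertex is zero.  Since G has no loops, an adjacent pair of vertices
-- both lying in {x , y} is exactly the edge xy, which is removed.
subdivide : (G : Graph) (x y : Vertex G) → Adj G x y → Graph
subdivide G x y _ = record
  { order  = suc (order G)
  ; Adj    = adj
  ; Adj?   = adj?
  ; symm   = λ {i} {j} → adj-sym i j
  ; irrefl = λ {i} → adj-irr i
  }
  where
  End : Pred (Vertex G) 0ℓ
  End v = v ≡ x ⊎ v ≡ y

  end? : U.Decidable End
  end? v = (v ≟ x) ⊎-dec (v ≟ y)

  adj : Rel (Fin (suc (order G))) 0ℓ
  adj zero    zero    = ⊥
  adj zero    (suc v) = End v
  adj (suc u) zero    = End u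
  adj (suc u) (suc v) = Adj G u v × ¬ (End u × End v)

  adj? : Decidable adj
  adj? zero    zero    = no λ ()
  adj? zero    (suc v) = end? v
  adj? (suc u) zero    = end? u
  adj? (suc u) (suc v) = Graph.Adj? G u v ×-dec ¬? (end? u ×-dec end? v)

  adj-sym : ∀ i j → adj i j → adj j i
  adj-sym zero    (suc _) e       = e
  adj-sym (suc _) zero    e       = e
  adj-sym (suc _) (suc _) (a , n) = Graph.symm G a , λ (p , q) → n (q , p)

  adj-irr : ∀ i → ¬ adj i i
  adj-irr zero    ()
  adj-irr (suc _) (a , _) = Graph.irrefl G a

star⁺ : (r : ℕ) → r ≥ 1 → Graph
star⁺ r r≥1 = subdivide (star r) zero (suc (fromℕ< r≥1)) tt

IsVertexCover : (G : Graph) → Pred (Subset (order G)) 0ℓ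
IsVertexCover G S = ∀ u v → u ∉ S → v ∉ S → ¬ Adj G u v

IsIndependent : (G : Graph) → Pred (Subset (order G)) 0ℓ
IsIndependent G S = ∀ u v → u ∈ S → v ∈ S → ¬ Adj G u v

IsIndependentVertexCover : (G : Graph) → Pred (Subset (order G)) 0ℓ
IsIndependentVertexCover G S = IsIndependent G S × IsVertexCover G S

Bipartite : Graph → Set
Bipartite G = Σ[ c ∈ (Vertex G → Bool) ] (∀ u v → Adj G u v → c u ≢ c v)

record BipartiteGraph : Set₁ where
  field
    graph     : Graph
    bipartite : Bipartite graph

open BipartiteGraph using (graph)

IsMinimumSize : ∀ {n} → Pred (Subset n) 0ℓ → Pred ℕ 0ℓ
IsMinimumSize P k = (∃[ S ] P S × ∣ S ∣ ≡ k) × (∀ S → P S → k ≤ ∣ S ∣)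

module _ {n} {P : Pred (Subset n) 0ℓ} (P? : U.Decidable P) where

  private
    search : ∀ b S → P S → ∣ S ∣ < b → ∃ (IsMinimumSize P)
    search (suc b) S pS (s≤s S≤b)
      with anySubset? (λ T → P? T ×-dec (∣ T ∣ ℕ.<? ∣ S ∣))
    ... | yes (T , pT , T<S) = search b T pT (ℕ.<-≤-trans T<S S≤b)
    ... | no none = ∣ S ∣ , (S , pS , refl)
                  , λ T pT → ℕ.≮⇒≥ (λ T<S → none (T , pT , T<S))

  minimumSize : ∃ P → ∃ (IsMinimumSize P)
  minimumSize (S , pS) = search (suc ∣ S ∣) S pS ℕ.≤-refl

module _ (G : Graph) where

  isVertexCover? : U.Decidable (IsVertexCover G)
  isVertexCover? S = all? λ u → all? λ v →
    ¬? (u ∈? S) →-dec (¬? (v ∈? S) →-dec ¬? (Graph.Adj? G u v))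

  isIndependent? : U.Decidable (IsIndependent G)
  isIndependent? S = all? λ u → all? λ v →
    (u ∈? S) →-dec ((v ∈? S) →-dec ¬? (Graph.Adj? G u v))

  vertexCover : ∃ (IsVertexCover G)
  vertexCover = ⊤ , λ _ _ u∉ _ _ → u∉ ∈⊤

  independentVertexCover : Bipartite G → ∃ (IsIndependentVertexCover G)
  independentVertexCover (c , proper) = S , indep , cover
    where
    S : Subset (order G)
    S = tabulate c

    ∈⇒ : ∀ {v} → v ∈ S → c v ≡ true
    ∈⇒ {v} v∈ = trans (sym (lookup∘tabulate c v)) ([]=⇒lookup v∈)

    ∉⇒ : ∀ {v} → v ∉ S → c v ≡ false
    ∉⇒ {v} v∉ with c v in eq
    ... | false = refl
    ... | true  = contradiction (lookup⇒[]= v S (trans (lookup∘tabulate c v) eq)) v∉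

    indep : IsIndependent G S
    indep u v u∈ v∈ a = proper u v a (trans (∈⇒ u∈) (sym (∈⇒ v∈)))

    cover : IsVertexCover G S
    cover u v u∉ v∉ a = proper u v a (trans (∉⇒ u∉) (sym (∉⇒ v∉)))

  vc-minimum : ∃ (IsMinimumSize (IsVertexCover G))
  vc-minimum = minimumSize isVertexCover? vertexCover

  vc : ℕ
  vc = proj₁ vc-minimum

ivc-minimum : (B : BipartiteGraph) →
              ∃ (IsMinimumSize (IsIndependentVertexCover (graph B)))
ivc-minimum B =
  minimumSize (λ S → isIndependent? G S ×-dec isVertexCover? G S)
              (independentVertexCover G (BipartiteGraph.bipartite B))
  where G = graph B

-- Being a minimum, this does not depend on the chosen bipartition.
ivc : BipartiteGraph → ℕ
ivc B = proj₁ (ivc-minimum B)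

IvcBounded : Pred BipartiteGraph 0ℓ → Set₁
IvcBounded X = Σ[ f ∈ (ℕ → ℕ) ] (∀ B → X B → ivc B ≤ f (vc (graph B)))

FreeBipartite : Graph → Pred BipartiteGraph 0ℓ
FreeBipartite H B = (H IsFree) (graph B)

{-# OPTIONS --safe #-}
module Submission where

-- Necessity: join two copies of K₁,ₙ by an edge, either between the centres or
-- between two leaves.  In both graphs the centres lie on opposite sides, so ivc
-- is at least n while vc is at most 3, and H embeds into both for large n.  An
-- induced subgraph of the first one falls under K₁,ₙ + nP₁ or K⁺₁,ₙ₊₁ unless it
-- has two adjacent vertices of degree at least 3, which the second one excludes.
--
-- Sufficiency: let S be a minimum vertex cover; every vertex outside S has all
-- its neighbours in S.  If each vertex has at most M neighbours outside S, then
-- a side, less its isolated vertices, has at most |S|(M + 1) vertices.  In the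
-- presence of a vertex with many neighbours outside S, the absence of
-- K₁,ᵣ + rP₁ or K⁺₁,ᵣ puts nearly all of that vertex's side into S, in the second
-- case within its component only.

open import Defs
open import Data.Bool.Base using (Bool; true; false; not)
open import Data.Bool.Properties using (¬-not; not-injective; not-¬)
import Data.Bool.Properties as Bool
open import Data.Fin.Base using (Fin; zero; suc; splitAt; join; cast; fromℕ<)
open import Data.Fin.Properties
  using (_≟_; any?; all?; splitAt-join; join-splitAt; cast-involutive; suc-injective; 0≢1+n)
open import Data.Fin.Subset
  using (Subset; ∣_∣; _∈_; _∉_; _⊆_; _∪_; _∩_; _─_; _-_; ⊥; ⁅_⁆)
open import Data.Fin.Subset.Properties
open import Data.Nat.Base using (ℕ; zero; suc; _+_; _*_; _≤_; _<_; _≥_; z≤n; s≤s)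
import Data.Nat.Properties as ℕ
open import Data.Product.Base using (Σ-syntax; ∃; ∃-syntax; _×_; _,_; proj₁; proj₂)
open import Data.Sum.Base using (_⊎_; inj₁; inj₂; [_,_]′; swap)
open import Data.Sum.Relation.Binary.Pointwise as Pw using (Pointwise)
open import Data.Sum.Properties using (inj₁-injective; inj₂-injective; swap-involutive; ≡-dec)
open import Data.Unit.Base using (tt) renaming (⊤ to Unit)
open import Data.Vec.Base using (Vec; []; _∷_; here; there; tabulate; lookup)
open import Data.Vec.Properties using (lookup∘tabulate; []=⇒lookup; lookup⇒[]=)
open import Function.Base using (_∘_; id)
open import Function.Bundles using (_⇔_; mk⇔; Equivalence)
open import Function.Definitions using (Injective)
open import Level using (0ℓ)
open import Relation.Binary.Core using (Rel)
open import Relation.Binary.Definitions using (Decidable; Symmetric)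
open import Relation.Binary.PropositionalEquality
  using (_≡_; _≢_; refl; sym; trans; cong; subst; subst₂)
open import Relation.Nullary using (¬_; Dec; yes; no; does; contradiction)
open import Relation.Nullary.Decidable
  using (_×-dec_; _⊎-dec_; _→-dec_; ¬?; map′; dec-true; does-⇔)
open import Relation.Unary using (Pred)
import Relation.Unary as U

open Graph using (order; Adj; Adj?; Vertex; symm; irrefl)
open BipartiteGraph using (graph; bipartite)
open Equivalence using (to; from)

-- Finite subsets

∣p∪q∣≤∣p∣+∣q∣ : ∀ {n} (p q : Subset n) → ∣ p ∪ q ∣ ≤ ∣ p ∣ + ∣ q ∣
∣p∪q∣≤∣p∣+∣q∣ []          []          = z≤n
∣p∪q∣≤∣p∣+∣q∣ (true ∷ p)  (b ∷ q)     =
  s≤s (ℕ.≤-trans (∣p∪q∣≤∣p∣+∣q∣ p q) (ℕ.+-monoʳ-≤ ∣ p ∣ (∣p∣≤∣x∷p∣ b q)))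
∣p∪q∣≤∣p∣+∣q∣ (false ∷ p) (false ∷ q) = ∣p∪q∣≤∣p∣+∣q∣ p q
∣p∪q∣≤∣p∣+∣q∣ (false ∷ p) (true ∷ q)  =
  ℕ.≤-trans (s≤s (∣p∪q∣≤∣p∣+∣q∣ p q)) (ℕ.≤-reflexive (sym (ℕ.+-suc ∣ p ∣ ∣ q ∣)))

x∈p─q⇒x∉q : ∀ {n} (p q : Subset n) {x} → x ∈ p ─ q → x ∉ q
x∈p─q⇒x∉q (_ ∷ p) (_ ∷ q) (there x∈) (there x∈q) = x∈p─q⇒x∉q p q x∈ x∈q
x∈p─q⇒x∉q (_ ∷ p) (_ ∷ q) ()         here

∣p∣≤∣q∣+∣p─q∣ : ∀ {n} (p q : Subset n) → ∣ p ∣ ≤ ∣ q ∣ + ∣ p ─ q ∣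
∣p∣≤∣q∣+∣p─q∣ p q = ℕ.≤-trans (p⊆q⇒∣p∣≤∣q∣ p⊆) (∣p∪q∣≤∣p∣+∣q∣ q (p ─ q))
  where
  p⊆ : p ⊆ q ∪ (p ─ q)
  p⊆ {x} x∈p with x ∈? q
  ... | yes x∈q = x∈p∪q⁺ (inj₁ x∈q)
  ... | no  x∉q = x∈p∪q⁺ (inj₂ (x∈p∧x∉q⇒x∈p─q x∈p x∉q))

-- Induction on `S`: the set of a first index in `S` is removed from `T` at a cost of at most `M`,
-- and what remains is covered by the other indices.
union-bound : ∀ {m n} (S : Subset m) (F : Fin m → Subset n) (T : Subset n) M →
              (∀ i → i ∈ S → ∣ F i ∣ ≤ M) →
              (∀ t → t ∈ T → ∃[ i ] i ∈ S × t ∈ F i) →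
              ∣ T ∣ ≤ ∣ S ∣ * M
union-bound {n = n} [] F T M _ cov =
  ℕ.≤-trans (p⊆q⇒∣p∣≤∣q∣ {q = ⊥} λ t∈ → absurd (cov _ t∈)) (ℕ.≤-reflexive (∣⊥∣≡0 n))
  where
  absurd : ∀ {t} → (∃[ i ] i ∈ [] × t ∈ F i) → t ∈ ⊥
  absurd (() , _)
union-bound (false ∷ S) F T M small cov =
  union-bound S (F ∘ suc) T M (λ i → small (suc i) ∘ there) cov′
  where
  cov′ : ∀ t → t ∈ T → ∃[ i ] i ∈ S × t ∈ F (suc i)
  cov′ t t∈ with cov t t∈
  ... | suc i , there i∈ , t∈F = i , i∈ , t∈F
union-bound (true ∷ S) F T M small cov =
  ℕ.≤-trans (∣p∣≤∣q∣+∣p─q∣ T (F zero))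
    (ℕ.+-mono-≤ (small zero here)
      (union-bound S (F ∘ suc) (T ─ F zero) M (λ i → small (suc i) ∘ there) cov′))
  where
  cov′ : ∀ t → t ∈ T ─ F zero → ∃[ i ] i ∈ S × t ∈ F (suc i)
  cov′ t t∈ with cov t (p─q⊆p T (F zero) t∈)
  ... | zero  , _        , t∈F = contradiction t∈F (x∈p─q⇒x∉q T (F zero) t∈)
  ... | suc i , there i∈ , t∈F = i , i∈ , t∈F

injection⇒≤∣p∣ : ∀ {m n} (p : Subset n) (f : Fin m → Fin n) →
                 Injective _≡_ _≡_ f → (∀ i → f i ∈ p) → m ≤ ∣ p ∣
injection⇒≤∣p∣ {zero}  p f inj f∈ = z≤n
injection⇒≤∣p∣ {suc m} p f inj f∈ = ℕ.≤-<-trans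
  (injection⇒≤∣p∣ (p - f zero) (f ∘ suc) (suc-injective ∘ inj)
    λ i → x∈p∧x∉q⇒x∈p─q (f∈ (suc i)) λ e → 0≢1+n (inj (sym (x∈⁅y⁆⇒x≡y _ e))))
  (x∈p⇒∣p-x∣<∣p∣ (f∈ zero))

≤∣p∣⇒injection : ∀ {m n} (p : Subset n) → m ≤ ∣ p ∣ →
                 Σ[ f ∈ (Fin m → Fin n) ] Injective _≡_ _≡_ f × (∀ i → f i ∈ p)
≤∣p∣⇒injection {zero}  p _ = (λ ()) , (λ { {()} }) , λ ()
≤∣p∣⇒injection {suc m} (false ∷ p) m≤ with ≤∣p∣⇒injection p m≤
... | f , inj , f∈ = suc ∘ f , inj ∘ suc-injective , there ∘ f∈
≤∣p∣⇒injection {suc m} (true ∷ p) (s≤s m≤) with ≤∣p∣⇒injection p m≤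
... | f , inj , f∈ = f′ , inj′ , f′∈
  where
  f′ : Fin (suc m) → Fin _
  f′ zero    = zero
  f′ (suc i) = suc (f i)

  inj′ : Injective _≡_ _≡_ f′
  inj′ {zero}  {zero}  _ = refl
  inj′ {suc _} {suc _} e = cong suc (inj (suc-injective e))

  f′∈ : ∀ i → f′ i ∈ true ∷ p
  f′∈ zero    = here
  f′∈ (suc i) = there (f∈ i)

module _ {n} {P : Pred (Fin n) 0ℓ} (P? : U.Decidable P) where

  comprehension : Subset n
  comprehension = tabulate (does ∘ P?)

  ∈-comprehension⁺ : ∀ {x} → P x → x ∈ comprehension
  ∈-comprehension⁺ {x} px =
    lookup⇒[]= x _ (trans (lookup∘tabulate _ x) (dec-true (P? x) px))

  ∈-comprehension⁻ : ∀ {x} → x ∈ comprehension → P x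
  ∈-comprehension⁻ {x} x∈
    with P? x | trans (sym (lookup∘tabulate (does ∘ P?) x)) ([]=⇒lookup x∈)
  ... | yes px | _  = px
  ... | no _   | ()

-- Embeddings

infix 4 _↪_

-- An induced embedding into an adjacency relation whose vertices need not form
-- a Fin; H ⊑ G unfolds to H ↪ Adj G.
_↪_ : Graph → {A : Set} → Rel A 0ℓ → Set
_↪_ H {A} R = Σ[ f ∈ (Vertex H → A) ]
                Injective _≡_ _≡_ f × (∀ u v → Adj H u v ⇔ R (f u) (f v))

↪-refl : ∀ G → G ↪ Adj G
↪-refl G = id , id , λ _ _ → mk⇔ id id

module _ {H : Graph} {A B : Set} {R : Rel A 0ℓ} {R′ : Rel B 0ℓ}
         (e : H ↪ R) (g : A → B) where

  private
    f = proj₁ e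

  module _ (P : Rel A 0ℓ) (image : ∀ u v → P (f u) (f v))
           (inj : ∀ {x y} → P x y → g x ≡ g y → x ≡ y) where

    -- The hypotheses on `g` concern only pairs satisfying `P`, which holds throughout the image of
    -- the embedding; so `g` may merge vertices that the image avoids.
    ↪-map : (∀ {x y} → P x y → R x y ⇔ R′ (g x) (g y)) → H ↪ R′
    ↪-map adj = g ∘ f , (λ eq → proj₁ (proj₂ e) (inj (image _ _) eq))
              , λ u v → mk⇔ (to (adj (image u v)) ∘ to (proj₂ (proj₂ e) u v))
                            (from (proj₂ (proj₂ e) u v) ∘ from (adj (image u v)))

    module _ (a : A → Bool) (a-proper : ∀ {x y} → R x y → a x ≢ a y)
             (b : B → Bool) (b-proper : ∀ {x y} → R′ x y → b x ≢ b y)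
             (b∘g : ∀ x → b (g x) ≡ a x)
             (R-sym : Symmetric R) (R′-sym : Symmetric R′) (P-sym : Symmetric P) where

      -- As `g` respects the two proper colourings, pairs of equal colour are non-adjacent on both
      -- sides, and symmetry leaves one order of the mixed pairs to check.
      ↪-map-bipartite :
        (∀ {x y} → P x y → a x ≡ true → a y ≡ false → R x y ⇔ R′ (g x) (g y)) → H ↪ R′
      ↪-map-bipartite adj = ↪-map λ {x} {y} p → mk⇔ (fwd p) (bwd p)
        where
        fwd : ∀ {x y} → P x y → R x y → R′ (g x) (g y)
        fwd {x} {y} p r with a x in ax | a y in ay
        ... | true  | false = to (adj p ax ay) r
        ... | false | true  = R′-sym (to (adj (P-sym p) ay ax) (R-sym r))
        ... | true  | true  = contradiction (trans ax (sym ay)) (a-proper r)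
        ... | false | false = contradiction (trans ax (sym ay)) (a-proper r)

        bwd : ∀ {x y} → P x y → R′ (g x) (g y) → R x y
        bwd {x} {y} p r with a x in ax | a y in ay
        ... | true  | false = from (adj p ax ay) r
        ... | false | true  = R-sym (from (adj (P-sym p) ay ax) (R′-sym r))
        ... | true  | true  =
          contradiction (trans (trans (b∘g x) (trans ax (sym ay))) (sym (b∘g y))) (b-proper r)
        ... | false | false =
          contradiction (trans (trans (b∘g x) (trans ax (sym ay))) (sym (b∘g y))) (b-proper r)

⊑-trans : ∀ {H G K} → H ⊑ G → G ⊑ K → H ⊑ K
⊑-trans {H} {G} {K} e (g , inj , adj) =
  ↪-map {H = H} {R = Adj G} {R′ = Adj K} e g (λ _ _ → Unit) (λ _ _ → tt) (λ _ → inj) λ _ → adj _ _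

anyVec? : ∀ {n} m {P : Pred (Vec (Fin n) m) 0ℓ} → U.Decidable P → Dec (∃ P)
anyVec? zero    P? = map′ ([] ,_) (λ { ([] , p) → p }) (P? [])
anyVec? (suc m) P? =
  map′ (λ (x , xs , p) → x ∷ xs , p) (λ { (x ∷ xs , p) → x , xs , p })
       (any? λ x → anyVec? m (P? ∘ (x ∷_)))

infix 4 _⊑?_

-- Needed to obtain an embedding from the failure of `H`-freeness. Maps are searched for as vectors
-- of their values.
_⊑?_ : Decidable _⊑_
H ⊑? G = map′ fromVec toVec (anyVec? (order H) λ xs →
    (all? λ i → all? λ j → (lookup xs i ≟ lookup xs j) →-dec (i ≟ j))
    ×-dec
    (all? λ i → all? λ j →
      (Adj? H i j →-dec Adj? G (lookup xs i) (lookup xs j))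
      ×-dec
      (Adj? G (lookup xs i) (lookup xs j) →-dec Adj? H i j)))
  where
  IsEmbedding : Pred (Vec (Vertex G) (order H)) 0ℓ
  IsEmbedding xs =
    (∀ i j → lookup xs i ≡ lookup xs j → i ≡ j) ×
    (∀ i j → (Adj H i j → Adj G (lookup xs i) (lookup xs j)) ×
             (Adj G (lookup xs i) (lookup xs j) → Adj H i j))

  fromVec : ∃ IsEmbedding → H ⊑ G
  fromVec (xs , inj , adj) =
    lookup xs , inj _ _ , λ u v → mk⇔ (proj₁ (adj u v)) (proj₂ (adj u v))

  toVec : H ⊑ G → ∃ IsEmbedding
  toVec (f , inj , adj) =
    tabulate f
    , (λ i j eq → inj (trans (sym (at i)) (trans eq (at j))))
    , λ i j → (λ a → subst₂ (Adj G) (sym (at i)) (sym (at j)) (to (adj i j) a))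
            , (λ a → from (adj i j) (subst₂ (Adj G) (at i) (at j) a))
    where
    at : ∀ i → lookup (tabulate f) i ≡ f i
    at = lookup∘tabulate f

splitAt-injective : ∀ m {n} → Injective _≡_ _≡_ (splitAt m {n})
splitAt-injective m {n} {x} {y} eq =
  trans (sym (join-splitAt m n x)) (trans (cong (join m n) eq) (join-splitAt m n y))

join-injective : ∀ m n → Injective _≡_ _≡_ (join m n)
join-injective m n {x} {y} eq =
  trans (sym (splitAt-join m n x)) (trans (cong (splitAt m) eq) (splitAt-join m n y))

↪⇒⊑⊕ : ∀ {H} G K → H ↪ Pointwise (Adj G) (Adj K) → H ⊑ G ⊕ K
↪⇒⊑⊕ G K (f , inj , adj) =
  join _ _ ∘ f , inj ∘ join-injective (order G) (order K)
  , λ u v → subst₂ (λ x y → _ ⇔ Pointwise (Adj G) (Adj K) x y)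
                   (sym (splitAt-join _ _ (f u))) (sym (splitAt-join _ _ (f v))) (adj u v)

⊕-⊑ : ∀ {G K L} (e : G ⊑ L) (e′ : K ⊑ L) →
      (∀ u v → proj₁ e u ≢ proj₁ e′ v) → (∀ u v → ¬ Adj L (proj₁ e u) (proj₁ e′ v)) →
      G ⊕ K ⊑ L
⊕-⊑ {G} {K} {L} (f , f-inj , f-adj) (g , g-inj , g-adj) disj apart =
  ↪-map {H = G ⊕ K} {R = Pointwise (Adj G) (Adj K)} {R′ = Adj L}
    (splitAt (order G) , splitAt-injective (order G) , λ _ _ → mk⇔ id id)
    [ f , g ]′ (λ _ _ → Unit) (λ _ _ → tt) inj adj
  where
  inj : ∀ {x y} → Unit → [ f , g ]′ x ≡ [ f , g ]′ y → x ≡ y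
  inj {inj₁ x} {inj₁ y} _ eq = cong inj₁ (f-inj eq)
  inj {inj₁ x} {inj₂ y} _ eq = contradiction eq (disj x y)
  inj {inj₂ x} {inj₁ y} _ eq = contradiction (sym eq) (disj y x)
  inj {inj₂ x} {inj₂ y} _ eq = cong inj₂ (g-inj eq)

  adj : ∀ {x y} → Unit → Pointwise (Adj G) (Adj K) x y ⇔ Adj L ([ f , g ]′ x) ([ f , g ]′ y)
  adj {inj₁ x} {inj₁ y} _ = mk⇔ (λ { (Pw.inj₁ a) → to (f-adj x y) a }) (Pw.inj₁ ∘ from (f-adj x y))
  adj {inj₁ x} {inj₂ y} _ = mk⇔ (λ ()) (λ a → contradiction a (apart x y))
  adj {inj₂ x} {inj₁ y} _ = mk⇔ (λ ()) (λ a → contradiction (symm L a) (apart y x))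
  adj {inj₂ x} {inj₂ y} _ = mk⇔ (λ { (Pw.inj₂ a) → to (g-adj x y) a }) (Pw.inj₂ ∘ from (g-adj x y))

order-r·P₁ : ∀ r → order (r · path 1) ≡ r
order-r·P₁ zero    = refl
order-r·P₁ (suc r) = cong suc (order-r·P₁ r)

r·P₁-edgeless : ∀ r u v → ¬ Adj (r · path 1) u v
r·P₁-edgeless (suc r) u v with splitAt 1 u | splitAt 1 v
... | inj₁ zero | inj₁ zero = λ { (Pw.inj₁ (inj₁ ())) ; (Pw.inj₁ (inj₂ ())) }
... | inj₁ _    | inj₂ _    = λ ()
... | inj₂ _    | inj₁ _    = λ ()
... | inj₂ x    | inj₂ y    = λ { (Pw.inj₂ a) → r·P₁-edgeless r x y a }

cast-injective : ∀ {m n} (eq : m ≡ n) → Injective _≡_ _≡_ (cast eq)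
cast-injective eq {x} {y} e =
  trans (sym (cast-involutive (sym eq) eq x))
        (trans (cong (cast (sym eq)) e) (cast-involutive (sym eq) eq y))

-- Two-colourings of the stars

star-colour : ∀ {n} → Fin (suc n) → Bool
star-colour zero    = true
star-colour (suc _) = false

star-proper : ∀ {n} {u v} → Adj (star n) u v → star-colour u ≢ star-colour v
star-proper {u = zero}  {suc _} _ ()
star-proper {u = suc _} {zero}  _ ()

-- In star⁺ the subdividing vertex is zero, the centre is suc zero, and the leaf
-- at the far end of the subdivided edge is suc (suc zero).
star⁺-colour : ∀ {n} → Fin (suc (suc n)) → Bool
star⁺-colour zero                = false
star⁺-colour (suc zero)          = true
star⁺-colour (suc (suc zero))    = true
star⁺-colour (suc (suc (suc _))) = false

star⁺-proper : ∀ {s} {u v} → Adj (star⁺ (suc s) (s≤s z≤n)) u v →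
               star⁺-colour u ≢ star⁺-colour v
star⁺-proper {u = zero}                {suc zero}          _ ()
star⁺-proper {u = zero}                {suc (suc zero)}    _ ()
star⁺-proper {u = zero}                {suc (suc (suc _))} (inj₁ ())
star⁺-proper {u = zero}                {suc (suc (suc _))} (inj₂ ())
star⁺-proper {u = suc zero}            {zero}              _ ()
star⁺-proper {u = suc zero}            {suc (suc zero)}    (_ , n) _ = n (inj₁ refl , inj₂ refl)
star⁺-proper {u = suc zero}            {suc (suc (suc _))} _ ()
star⁺-proper {u = suc (suc zero)}      {zero}              _ ()
star⁺-proper {u = suc (suc zero)}      {suc zero}          (_ , n) _ = n (inj₂ refl , inj₁ refl)
star⁺-proper {u = suc (suc (suc _))}   {zero}              (inj₁ ())
star⁺-proper {u = suc (suc (suc _))}   {zero}              (inj₂ ())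
star⁺-proper {u = suc (suc (suc _))}   {suc zero}          _ ()
star⁺-proper {u = suc (suc zero)}      {suc (suc (suc _))} ()
star⁺-proper {u = suc (suc (suc _))}   {suc (suc zero)}    ()
star⁺-proper {u = suc (suc zero)}      {suc (suc zero)}    (() , _)
star⁺-proper {u = suc (suc (suc _))}   {suc (suc (suc _))} (() , _)

-- Sufficiency

Proper : (G : Graph) → (Vertex G → Bool) → Set
Proper G c = ∀ u v → Adj G u v → c u ≢ c v

module _ {G : Graph} {c : Vertex G → Bool} (proper : Proper G c) where

  neighbour-of-true : ∀ {u v} → c u ≡ true → Adj G u v → c v ≡ false
  neighbour-of-true cu a = trans (¬-not λ e → proper _ _ a (sym e)) (cong not cu)

  neighbour-of-false : ∀ {u v} → c u ≡ false → Adj G u v → c v ≡ true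
  neighbour-of-false cu a = trans (¬-not λ e → proper _ _ a (sym e)) (cong not cu)

  monochromatic-nonadjacent : ∀ {u v b} → c u ≡ b → c v ≡ b → ¬ Adj G u v
  monochromatic-nonadjacent cu cv a = proper _ _ a (trans cu (sym cv))

  recolour-true : ∀ v → Σ[ d ∈ (Vertex G → Bool) ] Proper G d × d v ≡ true
  recolour-true v with c v in cv
  ... | true  = c , proper , cv
  ... | false = not ∘ c , (λ x y a → proper x y a ∘ not-injective) , cong not cv

-- Vertex covers and the sides of a bipartition

module Cover (G : Graph) (S : Subset (order G)) (cover : IsVertexCover G S) where

  N : Vertex G → Subset (order G)
  N v = comprehension (Adj? G v)

  N∖S : Vertex G → Subset (order G)
  N∖S v = N v ─ S

  ∈N⁻ : ∀ {v u} → u ∈ N v → Adj G v u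
  ∈N⁻ {v} = ∈-comprehension⁻ (Adj? G v)

  ∈N∖S⁺ : ∀ {v u} → Adj G v u → u ∉ S → u ∈ N∖S v
  ∈N∖S⁺ {v} a = x∈p∧x∉q⇒x∈p─q (∈-comprehension⁺ (Adj? G v) a)

  ∈N∖S⇒Adj : ∀ {v u} → u ∈ N∖S v → Adj G v u
  ∈N∖S⇒Adj {v} u∈ = ∈N⁻ (p─q⊆p (N v) S u∈)

  ∈N∖S⇒∉S : ∀ {v u} → u ∈ N∖S v → u ∉ S
  ∈N∖S⇒∉S {v} = x∈p─q⇒x∉q (N v) S

  neighbour∈S : ∀ {u v} → u ∉ S → Adj G v u → v ∈ S
  neighbour∈S {u} {v} u∉ a with v ∈? S
  ... | yes v∈ = v∈
  ... | no  v∉ = contradiction a (cover v u v∉ u∉)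

  -- A vertex outside `S` has all its neighbours in `S`. Hence `T ─ S` is covered by those sets
  -- `N∖S v`, with `v` in `S`, that have at most `M` elements.
  covered-size : ∀ T M →
    (∀ t → t ∈ T → t ∉ S → ∃[ v ] Adj G v t × ∣ N∖S v ∣ ≤ M) →
    ∣ T ∣ ≤ ∣ S ∣ * suc M
  covered-size T M near = begin
    ∣ T ∣               ≤⟨ ∣p∣≤∣q∣+∣p─q∣ T S ⟩
    ∣ S ∣ + ∣ T ─ S ∣   ≤⟨ ℕ.+-monoʳ-≤ ∣ S ∣ (union-bound S′ N∖S (T ─ S) M small cov) ⟩
    ∣ S ∣ + ∣ S′ ∣ * M  ≤⟨ ℕ.+-monoʳ-≤ ∣ S ∣ (ℕ.*-monoˡ-≤ M (∣p∩q∣≤∣p∣ S Small)) ⟩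
    ∣ S ∣ + ∣ S ∣ * M   ≡⟨ ℕ.*-suc ∣ S ∣ M ⟨
    ∣ S ∣ * suc M       ∎
    where
    open ℕ.≤-Reasoning

    small? : U.Decidable (λ v → ∣ N∖S v ∣ ≤ M)
    small? v = ∣ N∖S v ∣ ℕ.≤? M

    Small S′ : Subset (order G)
    Small = comprehension small?
    S′    = S ∩ Small

    small : ∀ v → v ∈ S′ → ∣ N∖S v ∣ ≤ M
    small v v∈ = ∈-comprehension⁻ small? (proj₂ (x∈p∩q⁻ S Small v∈))

    cov : ∀ t → t ∈ T ─ S → ∃[ v ] v ∈ S′ × t ∈ N∖S v
    cov t t∈ with near t (p─q⊆p T S t∈) (x∈p─q⇒x∉q T S t∈)
    ... | v , a , v-small =
      v , x∈p∩q⁺ (neighbour∈S t∉ a , ∈-comprehension⁺ small? v-small) , ∈N∖S⁺ a t∉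
      where t∉ = x∈p─q⇒x∉q T S t∈

  module Side (d : Vertex G → Bool) (proper : Proper G d) where

    -- Isolated vertices are left out: they cover no edge, and their number is not controlled by
    -- `S`.
    InSide : Pred (Vertex G) 0ℓ
    InSide u = d u ≡ true × ∃[ v ] Adj G v u

    inSide? : U.Decidable InSide
    inSide? u = (d u Bool.≟ true) ×-dec any? λ v → Adj? G v u

    side : Subset (order G)
    side = comprehension inSide?

    side-ivc : IsIndependentVertexCover G side
    side-ivc = indep , cov
      where
      indep : IsIndependent G side
      indep u v u∈ v∈ = monochromatic-nonadjacent {G} proper
        (proj₁ (∈-comprehension⁻ inSide? u∈)) (proj₁ (∈-comprehension⁻ inSide? v∈))

      cov : IsVertexCover G side
      cov u v u∉ v∉ a with d u in du
      ... | true  = u∉ (∈-comprehension⁺ inSide? (du , v , symm G a))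
      ... | false = v∉ (∈-comprehension⁺ inSide? (neighbour-of-false {G} proper du a , u , a))

    side-size : ∀ M → (∀ u v → d u ≡ true → u ∉ S → Adj G v u → ∣ N∖S v ∣ ≤ M) →
                ∣ side ∣ ≤ ∣ S ∣ * suc M
    side-size M small = covered-size side M λ t t∈ t∉ →
      let dt , v , a = ∈-comprehension⁻ inSide? t∈ in v , a , small t v dt t∉ a

-- Excluding a star with isolated vertices

module StarPlusIsolated (G : Graph) (S : Subset (order G)) (cover : IsVertexCover G S)
                        (r : ℕ) (r≥1 : r ≥ 1) (free : ((star r ⊕ r · path 1) IsFree) G) where

  open Cover G S cover

  module _ (c : Vertex G → Bool) (proper : Proper G c) (v : Vertex G) (cv : c v ≡ true)
           (big : r ≤ ∣ N∖S v ∣) where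

    open Side c proper

    module _ (many : r ≤ ∣ side ─ S ∣) where

      private
        gs = ≤∣p∣⇒injection (N∖S v) big
        g  = proj₁ gs
        g∈ = proj₂ (proj₂ gs)
        hs = ≤∣p∣⇒injection (side ─ S) many
        h  = proj₁ hs
        h∈ = proj₂ (proj₂ hs)

        h-true : ∀ i → c (h i) ≡ true
        h-true i = proj₁ (∈-comprehension⁻ inSide? (p─q⊆p side S (h∈ i)))

        h∉S : ∀ i → h i ∉ S
        h∉S i = x∈p─q⇒x∉q side S (h∈ i)

        g-false : ∀ i → c (g i) ≡ false
        g-false i = neighbour-of-true {G} proper cv (∈N∖S⇒Adj (g∈ i))

        -- `r≥1` supplies a neighbour of `v` outside `S`, which forces `v` into `S`; this separates
        -- `v` from the vertices `h i`.
        v∈S : v ∈ S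
        v∈S = let i = fromℕ< r≥1
              in neighbour∈S (∈N∖S⇒∉S (g∈ i)) (∈N∖S⇒Adj (g∈ i))

        f : Vertex (star r) → Vertex G
        f zero    = v
        f (suc i) = g i

        f-colour : ∀ x → c (f x) ≡ star-colour x
        f-colour zero    = cv
        f-colour (suc i) = g-false i

        f-injective : ∀ {x y} → f x ≡ f y → x ≡ y
        f-injective {zero}  {zero}  _  = refl
        f-injective {suc i} {suc j} eq = cong suc (proj₁ (proj₂ gs) eq)
        f-injective {zero}  {suc j} eq =
          contradiction (trans (sym cv) (trans (cong c eq) (g-false j))) λ ()
        f-injective {suc i} {zero}  eq =
          contradiction (trans (sym cv) (trans (cong c (sym eq)) (g-false i))) λ ()

        f-adj : ∀ {x y} → star-colour x ≡ true → star-colour y ≡ false →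
                Adj (star r) x y ⇔ Adj G (f x) (f y)
        f-adj {zero} {suc j} _ _ = mk⇔ (λ _ → ∈N∖S⇒Adj (g∈ j)) (λ _ → tt)
        f-adj {zero} {zero} _ ()
        f-adj {suc i} ()

        star⊑ : star r ⊑ G
        star⊑ = ↪-map-bipartite {H = star r} {R = Adj (star r)} {R′ = Adj G}
          (↪-refl (star r)) f (λ _ _ → Unit) (λ _ _ → tt) (λ _ → f-injective)
          star-colour star-proper c (proper _ _) f-colour
          (λ {x} {y} → symm (star r) {x} {y}) (symm G) id (λ _ → f-adj)

        isolated⊑ : r · path 1 ⊑ G
        isolated⊑ = h ∘ cast (order-r·P₁ r)
          , cast-injective (order-r·P₁ r) ∘ proj₁ (proj₂ hs)
          , λ x y → mk⇔ (λ a → contradiction a (r·P₁-edgeless r x y))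
                        (λ a → contradiction a
                          (monochromatic-nonadjacent {G} proper (h-true _) (h-true _)))

        disjoint : ∀ x y → proj₁ star⊑ x ≢ proj₁ isolated⊑ y
        disjoint zero    y eq = h∉S _ (subst (_∈ S) eq v∈S)
        disjoint (suc i) y eq =
          contradiction (trans (sym (h-true _)) (trans (cong c (sym eq)) (g-false i))) λ ()

        apart : ∀ x y → ¬ Adj G (proj₁ star⊑ x) (proj₁ isolated⊑ y)
        apart zero    y = monochromatic-nonadjacent {G} proper cv (h-true _)
        apart (suc i) y = cover _ _ (∈N∖S⇒∉S (g∈ i)) (h∉S _)

      -- The star is `v` with `r` neighbours outside `S`. The `r` vertices `h i` on the side of `v`
      -- are non-adjacent to `v` and to each other by colour, and to the leaves because both lie
      -- outside the cover.
      big-side⇒⊑ : (star r ⊕ r · path 1) ⊑ G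
      big-side⇒⊑ = ⊕-⊑ {star r} {r · path 1} {G} star⊑ isolated⊑ disjoint apart

    side-of-big : ∣ side ∣ ≤ ∣ S ∣ + r
    side-of-big = ℕ.≤-trans (∣p∣≤∣q∣+∣p─q∣ side S)
      (ℕ.+-monoʳ-≤ ∣ S ∣ (ℕ.≰⇒≥ (free ∘ big-side⇒⊑)))

  -- If no vertex has `r` neighbours outside `S`, then `side-size` applies to the given colouring;
  -- otherwise the side of such a vertex has at most `r` vertices outside `S`. The bound dominates
  -- both cases.
  small-ivc : Bipartite G → ∃[ T ] IsIndependentVertexCover G T × ∣ T ∣ ≤ ∣ S ∣ * suc r + r
  small-ivc (c , proper) with any? (λ v → r ℕ.≤? ∣ N∖S v ∣)
  ... | no none = side , side-ivc
                , ℕ.≤-trans (side-size r λ u v _ _ _ → ℕ.≰⇒≥ λ r≤ → none (v , r≤)) (ℕ.m≤m+n _ r)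
    where open Side c proper
  ... | yes (v , big) with recolour-true {G} proper v
  ...   | d , d-proper , dv = side , side-ivc
                , ℕ.≤-trans
                    (side-of-big d d-proper v dv big)
                    (ℕ.+-monoˡ-≤ r (ℕ.m≤m*n ∣ S ∣ (suc r)))
    where open Side d d-proper

-- With star⁺ excluded, two vertices with a common neighbour have almost the
-- same neighbours, so all vertices on the side of a vertex with many neighbours
-- outside S, within its component, have a neighbour outside S and thus lie in S.
-- That side is taken in such components, the other one elsewhere.
module StarPlus (G : Graph) (S : Subset (order G)) (cover : IsVertexCover G S)
                (s : ℕ) (free : (star⁺ (suc s) (s≤s z≤n) IsFree) G)
                (c : Vertex G → Bool) (proper : Proper G c) where

  open Cover G S cover

  private
    K : Graph
    K = star⁺ (suc s) (s≤s z≤n)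

  module _ {v w u} (v≢w : v ≢ w) (cv : c v ≡ true) (cw : c w ≡ true)
           (vu : Adj G v u) (wu : Adj G w u) (many : s ≤ ∣ N∖S v ─ N w ∣) where

    private
      gs = ≤∣p∣⇒injection (N∖S v ─ N w) many
      g  = proj₁ gs
      g∈ = proj₂ (proj₂ gs)

      v-g : ∀ i → Adj G v (g i)
      v-g i = ∈N∖S⇒Adj (p─q⊆p (N∖S v) (N w) (g∈ i))

      w-g : ∀ i → ¬ Adj G w (g i)
      w-g i a = x∈p─q⇒x∉q (N∖S v) (N w) (g∈ i) (∈-comprehension⁺ (Adj? G w) a)

      u≢g : ∀ i → u ≢ g i
      u≢g i eq = w-g i (subst (Adj G w) eq wu)

      f : Vertex K → Vertex G
      f zero                = u
      f (suc zero)          = v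
      f (suc (suc zero))    = w
      f (suc (suc (suc i))) = g i

      f-colour : ∀ x → c (f x) ≡ star⁺-colour x
      f-colour zero                = neighbour-of-true {G} proper cv vu
      f-colour (suc zero)          = cv
      f-colour (suc (suc zero))    = cw
      f-colour (suc (suc (suc i))) = neighbour-of-true {G} proper cv (v-g i)

      -- Vertices of different colours are separated by `f-colour`, so only pairs of one colour
      -- remain.
      f-injective′ : ∀ x y → star⁺-colour x ≡ star⁺-colour y → f x ≡ f y → x ≡ y
      f-injective′ zero                zero                _ _  = refl
      f-injective′ zero                (suc (suc (suc j))) _ eq = contradiction eq (u≢g j)
      f-injective′ (suc zero)          (suc zero)          _ _  = refl
      f-injective′ (suc zero)          (suc (suc zero))    _ eq = contradiction eq v≢w
      f-injective′ (suc (suc zero))    (suc zero)          _ eq = contradiction (sym eq) v≢w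
      f-injective′ (suc (suc zero))    (suc (suc zero))    _ _  = refl
      f-injective′ (suc (suc (suc i))) zero                _ eq = contradiction (sym eq) (u≢g i)
      f-injective′ (suc (suc (suc i))) (suc (suc (suc j))) _ eq =
        cong (λ k → suc (suc (suc k))) (proj₁ (proj₂ gs) eq)

      f-injective : ∀ {x y} → f x ≡ f y → x ≡ y
      f-injective {x} {y} eq =
        f-injective′ x y (trans (sym (f-colour x)) (trans (cong c eq) (f-colour y))) eq

      f-adj : ∀ {x y} → star⁺-colour x ≡ true → star⁺-colour y ≡ false →
              Adj K x y ⇔ Adj G (f x) (f y)
      f-adj {suc zero}       {zero}              _ _ = mk⇔ (λ _ → vu) (λ _ → inj₁ refl)
      f-adj {suc zero}       {suc (suc (suc j))} _ _ =
        mk⇔ (λ _ → v-g j) (λ _ → tt , λ { (_ , inj₁ ()) ; (_ , inj₂ ()) })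
      f-adj {suc (suc zero)} {zero}              _ _ = mk⇔ (λ _ → wu) (λ _ → inj₂ refl)
      f-adj {suc (suc zero)} {suc (suc (suc j))} _ _ =
        mk⇔ (λ ()) (λ a → contradiction a (w-g j))

    -- `v` is the centre, `u` the subdividing vertex, `w` the far end, and the `s` vertices `g i`,
    -- adjacent to `v` but not to `w`, are the remaining leaves.
    common-neighbour⇒⊑ : K ⊑ G
    common-neighbour⇒⊑ = ↪-map-bipartite {H = K} {R = Adj K} {R′ = Adj G}
      (↪-refl K) f (λ _ _ → Unit) (λ _ _ → tt) (λ _ → f-injective)
      star⁺-colour star⁺-proper c (proper _ _) f-colour
      (λ {x} {y} → symm K {x} {y}) (symm G) id (λ _ → f-adj)

  -- The inequality is weak so that the relation is reflexive even when `s` is zero.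
  AlmostNested : Rel (Vertex G) 0ℓ
  AlmostNested v w = ∣ N∖S v ─ N w ∣ ≤ s

  almostNested-refl : ∀ v → AlmostNested v v
  almostNested-refl v = ℕ.≤-trans (p⊆q⇒∣p∣≤∣q∣ {q = ⊥} empty)
    (ℕ.≤-trans (ℕ.≤-reflexive (∣⊥∣≡0 (order G))) z≤n)
    where
    empty : N∖S v ─ N v ⊆ ⊥
    empty x∈ = contradiction (p─q⊆p (N v) S (p─q⊆p (N∖S v) (N v) x∈))
                             (x∈p─q⇒x∉q (N∖S v) (N v) x∈)

  common-neighbour : ∀ {v w u} → c v ≡ true → c w ≡ true → Adj G v u → Adj G w u →
                     AlmostNested v w
  common-neighbour {v} {w} cv cw vu wu with v ≟ w
  ... | yes refl = almostNested-refl v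
  ... | no  v≢w  = ℕ.≰⇒≥ (free ∘ common-neighbour⇒⊑ v≢w cv cw vu wu)

  -- The threshold `s + s` ensures that two almost nested steps cannot lose all of `N∖S v`.
  -- `NearBig` also takes in the neighbours of near vertices, which makes it a union of components.
  Big Near NearBig : Pred (Vertex G) 0ℓ
  Big v     = c v ≡ true × s + s < ∣ N∖S v ∣
  Near u    = ∃[ v ] Big v × AlmostNested v u
  NearBig u = ∃[ w ] (c w ≡ true × Near w) × (u ≡ w ⊎ Adj G u w)

  nearBig? : U.Decidable NearBig
  nearBig? u = any? λ w →
    ((c w Bool.≟ true) ×-dec
      any? λ v → ((c v Bool.≟ true) ×-dec (s + s ℕ.<? ∣ N∖S v ∣))
                 ×-dec (∣ N∖S v ─ N w ∣ ℕ.≤? s))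
    ×-dec ((u ≟ w) ⊎-dec Adj? G u w)

  -- If `w′` is adjacent to a vertex of `N∖S v`, then `v` and `w′` have a common neighbour and are
  -- related directly, so errors do not accumulate along a walk. Otherwise each vertex of `N∖S v` is
  -- missed by `w`, or is adjacent to `w` and missed by `w′`: at most `s + s` in all, against
  -- `Big v`.
  near-step : ∀ {w w′ u} → c w ≡ true → c w′ ≡ true → Adj G w u → Adj G w′ u → Near w → Near w′
  near-step {w} {w′} {u} cw cw′ wu w′u (v , (cv , big) , vw) with nonempty? (N∖S v ∩ N w′)
  ... | yes (y , y∈) = v , (cv , big)
    , common-neighbour cv cw′ (∈N∖S⇒Adj (proj₁ y∈′)) (∈N⁻ (proj₂ y∈′))
    where y∈′ = x∈p∩q⁻ (N∖S v) (N w′) y∈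
  ... | no none = contradiction big (ℕ.≤⇒≯ (begin
    ∣ N∖S v ∣                                  ≤⟨ p⊆q⇒∣p∣≤∣q∣ split ⟩
    ∣ (N∖S v ─ N w) ∪ (N∖S w ─ N w′) ∣         ≤⟨ ∣p∪q∣≤∣p∣+∣q∣ (N∖S v ─ N w) (N∖S w ─ N w′) ⟩
    ∣ N∖S v ─ N w ∣ + ∣ N∖S w ─ N w′ ∣         ≤⟨ ℕ.+-mono-≤ vw (common-neighbour cw cw′ wu w′u) ⟩
    s + s                                      ∎))
    where
    open ℕ.≤-Reasoning

    split : N∖S v ⊆ (N∖S v ─ N w) ∪ (N∖S w ─ N w′)
    split {x} x∈ with x ∈? N w
    ... | no  x∉ = x∈p∪q⁺ (inj₁ (x∈p∧x∉q⇒x∈p─q x∈ x∉))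
    ... | yes x∈w = x∈p∪q⁺ (inj₂ (x∈p∧x∉q⇒x∈p─q (∈N∖S⁺ (∈N⁻ x∈w) (∈N∖S⇒∉S x∈))
                                  λ x∈w′ → none (x , x∈p∩q⁺ (x∈ , x∈w′))))

  nearBig-true : ∀ {u} → c u ≡ true → NearBig u → Near u
  nearBig-true cu (_ , (_  , near) , inj₁ refl) = near
  nearBig-true cu (_ , (cw , _)    , inj₂ a)    =
    contradiction a (monochromatic-nonadjacent {G} proper cu cw)

  -- If `u` is coloured `true`, it is itself the near vertex adjacent to `v`. Otherwise `u` is a
  -- common neighbour of a near vertex `w` and `v`, and `near-step` applies.
  nearBig-step : ∀ {u v} → Adj G u v → NearBig u → NearBig v
  nearBig-step {u} {v} a near with c u in cu
  ... | true = u , (cu , nearBig-true cu near) , inj₂ (symm G a)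
  nearBig-step {u} {v} a (w , (cw , near) , inj₁ refl) | false =
    contradiction (trans (sym cw) cu) λ ()
  nearBig-step {u} {v} a (w , (cw , near) , inj₂ uw) | false =
    v , (cv , near-step cw cv (symm G uw) (symm G a) near) , inj₁ refl
    where cv = neighbour-of-false {G} proper cu a

  agree : Bool → Bool → Bool
  agree true  b = b
  agree false b = not b

  agree-injective : ∀ a {x y} → agree a x ≡ agree a y → x ≡ y
  agree-injective true  = id
  agree-injective false = not-injective

  d : Vertex G → Bool
  d u = agree (does (nearBig? u)) (c u)

  -- `NearBig` is constant along edges, so the colours of adjacent vertices are both kept or both
  -- flipped.
  d-proper : Proper G d
  d-proper u v a eq = proper u v a (agree-injective (does (nearBig? v))
    (trans (cong (λ b → agree b (c u)) (sym same)) eq))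
    where
    same : does (nearBig? u) ≡ does (nearBig? v)
    same = does-⇔ (mk⇔ (nearBig-step a) (nearBig-step (symm G a))) (nearBig? u) (nearBig? v)

  -- For `u` outside `S`, no neighbour of `u` is outside `S`, so all of `N∖S v` is missed by `u` and
  -- has at most `s` elements, against `Big v`.
  near⇒∈S : ∀ {u} → Near u → u ∈ S
  near⇒∈S {u} (v , (_ , big) , nested) with u ∈? S
  ... | yes u∈ = u∈
  ... | no  u∉ = contradiction big (ℕ.≤⇒≯ (ℕ.≤-trans (p⊆q⇒∣p∣≤∣q∣ outside)
                                     (ℕ.≤-trans nested (ℕ.m≤m+n s s))))
    where
    outside : N∖S v ⊆ N∖S v ─ N u
    outside x∈ = x∈p∧x∉q⇒x∈p─q x∈ λ x∈Nu → cover _ _ u∉ (∈N∖S⇒∉S x∈) (∈N⁻ x∈Nu)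

  -- Where the colours are kept, `u` would be near and hence in `S`. Where they are flipped, `c v`
  -- is `true`, and a big `v` would make its neighbour `u` satisfy `NearBig`.
  d-small : ∀ u v → d u ≡ true → u ∉ S → Adj G v u → ∣ N∖S v ∣ ≤ s + s
  d-small u v du u∉ a with nearBig? u
  ... | yes near = contradiction (near⇒∈S (nearBig-true du near)) u∉
  ... | no far   = ℕ.≮⇒≥ λ big → far
    (v , (cv , v , (cv , big) , almostNested-refl v) , inj₂ (symm G a))
    where cv = neighbour-of-false {G} proper (not-injective du) (symm G a)

  small-ivc : ∃[ T ] IsIndependentVertexCover G T × ∣ T ∣ ≤ ∣ S ∣ * suc (s + s)
  small-ivc = side , side-ivc , side-size (s + s) d-small
    where open Side d d-proper

-- From small independent covers to ivc-boundedness

ivcBounded-mono : ∀ {X Y : Pred BipartiteGraph 0ℓ} →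
                  (∀ B → X B → Y B) → IvcBounded Y → IvcBounded X
ivcBounded-mono X⊆Y (f , bound) = f , λ B → bound B ∘ X⊆Y B

small-ivc⇒ivcBounded : ∀ {X : Pred BipartiteGraph 0ℓ} (f : ℕ → ℕ) →
  (∀ B → X B → ∀ S → IsVertexCover (graph B) S →
    ∃[ T ] IsIndependentVertexCover (graph B) T × ∣ T ∣ ≤ f ∣ S ∣) →
  IvcBounded X
small-ivc⇒ivcBounded f small = f , bound
  where
  bound : ∀ B → _ → ivc B ≤ f (vc (graph B))
  bound B xB with vc-minimum (graph B)
  ... | _ , (S , cover , refl) , _ =
    let T , T-ivc , T≤ = small B xB S cover
    in ℕ.≤-trans (proj₂ (proj₂ (ivc-minimum B)) T T-ivc) T≤

free-mono : ∀ {H K} → H ⊑ K → ∀ B → FreeBipartite H B → FreeBipartite K B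
free-mono {H} {K} H⊑K B free K⊑G = free (⊑-trans {H} {K} {graph B} H⊑K K⊑G)

sufficiency : ∀ H r (r≥1 : r ≥ 1) → H ⊑ star r ⊕ r · path 1 ⊎ H ⊑ star⁺ r r≥1 →
              IvcBounded (FreeBipartite H)
sufficiency H r r≥1 (inj₁ H⊑) =
  ivcBounded-mono (free-mono {H} {star r ⊕ r · path 1} H⊑)
    (small-ivc⇒ivcBounded (λ k → k * suc r + r) λ B free S cover →
      StarPlusIsolated.small-ivc (graph B) S cover r r≥1 free (bipartite B))
sufficiency H (suc s) (s≤s z≤n) (inj₂ H⊑) =
  ivcBounded-mono (free-mono {H} {star⁺ (suc s) (s≤s z≤n)} H⊑)
    (small-ivc⇒ivcBounded (λ k → k * suc (s + s)) λ B free S cover →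
      StarPlus.small-ivc (graph B) S cover s free (proj₁ (bipartite B)) (proj₂ (bipartite B)))

-- Necessity

module Linked (G : Graph) (p : Vertex G) where

  -- Two copies of `G` with one extra edge, between the copies of `p`; on the sum type, so that case
  -- analyses match on the copy directly.
  Link : Rel (Vertex G ⊎ Vertex G) 0ℓ
  Link (inj₁ u) (inj₁ v) = Adj G u v
  Link (inj₂ u) (inj₂ v) = Adj G u v
  Link (inj₁ u) (inj₂ v) = u ≡ p × v ≡ p
  Link (inj₂ u) (inj₁ v) = u ≡ p × v ≡ p

  link? : Decidable Link
  link? (inj₁ u) (inj₁ v) = Adj? G u v
  link? (inj₂ u) (inj₂ v) = Adj? G u v
  link? (inj₁ u) (inj₂ v) = (u ≟ p) ×-dec (v ≟ p)
  link? (inj₂ u) (inj₁ v) = (u ≟ p) ×-dec (v ≟ p)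

  link-sym : Symmetric Link
  link-sym {inj₁ u} {inj₁ v} a       = symm G a
  link-sym {inj₂ u} {inj₂ v} a       = symm G a
  link-sym {inj₁ u} {inj₂ v} (e , f) = f , e
  link-sym {inj₂ u} {inj₁ v} (e , f) = f , e

  link-irrefl : ∀ x → ¬ Link x x
  link-irrefl (inj₁ u) = irrefl G
  link-irrefl (inj₂ u) = irrefl G

  link-swap : ∀ {x y} → Link x y ⇔ Link (swap x) (swap y)
  link-swap {inj₁ u} {inj₁ v} = mk⇔ id id
  link-swap {inj₂ u} {inj₂ v} = mk⇔ id id
  link-swap {inj₁ u} {inj₂ v} = mk⇔ id id
  link-swap {inj₂ u} {inj₁ v} = mk⇔ id id

  -- The second copy has its colours exchanged so that the extra edge joins different colours.
  colour : (Vertex G → Bool) → Vertex G ⊎ Vertex G → Bool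
  colour c (inj₁ u) = c u
  colour c (inj₂ u) = not (c u)

  colour-proper : ∀ {c} → Proper G c → ∀ {x y} → Link x y → colour c x ≢ colour c y
  colour-proper proper {inj₁ u} {inj₁ v} a             = proper u v a
  colour-proper proper {inj₂ u} {inj₂ v} a             = proper u v a ∘ not-injective
  colour-proper proper {inj₁ u} {inj₂ v} (refl , refl) = not-¬ refl
  colour-proper proper {inj₂ u} {inj₁ v} (refl , refl) = not-¬ refl ∘ sym

  private
    split : Fin (order G + order G) → Vertex G ⊎ Vertex G
    split = splitAt (order G)

  linked : Graph
  linked = record
    { order  = order G + order G
    ; Adj    = λ u v → Link (split u) (split v)
    ; Adj?   = λ u v → link? (split u) (split v)
    ; symm   = λ {u} {v} → link-sym {split u} {split v}
    ; irrefl = λ {v} → link-irrefl (split v)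
    }

  vertex : Vertex G ⊎ Vertex G → Vertex linked
  vertex = join (order G) (order G)

  vertex-injective : Injective _≡_ _≡_ vertex
  vertex-injective = join-injective (order G) (order G)

  vertex-adj : ∀ {x y} → Link x y → Adj linked (vertex x) (vertex y)
  vertex-adj {x} {y} =
    subst₂ Link (sym (splitAt-join (order G) (order G) x)) (sym (splitAt-join (order G) (order G) y))

  linked-bipartite : Bipartite G → Bipartite linked
  linked-bipartite (c , proper) = colour c ∘ split
                                , λ u v → colour-proper proper {split u} {split v}

  ⊑linked⇒↪ : ∀ {H} → H ⊑ linked → H ↪ Link
  ⊑linked⇒↪ (f , inj , adj) = split ∘ f , inj ∘ splitAt-injective (order G) , adj

  ↪-swap : ∀ {H} → H ↪ Link → H ↪ Link
  ↪-swap {H} e = ↪-map {H = H} {R = Link} {R′ = Link} e swap (λ _ _ → Unit) (λ _ _ → tt)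
    (λ {x} {y} _ eq → trans (sym (swap-involutive x)) (trans (cong swap eq) (swap-involutive y)))
    (λ {x} {y} _ → link-swap {x} {y})

star-bipartite : ∀ n → Bipartite (star n)
star-bipartite n = star-colour , λ u v → star-proper {n} {u} {v}

-- Covers of two linked stars

module LinkedStars (n : ℕ) (p : Vertex (star n)) where

  open Linked (star n) p public

  B : BipartiteGraph
  B = record { graph = linked ; bipartite = linked-bipartite (star-bipartite n) }

  private
    x₁ x₂ p₁ : Vertex linked
    x₁ = vertex (inj₁ zero)
    x₂ = vertex (inj₂ zero)
    p₁ = vertex (inj₁ p)

    -- The centres cover the two stars, and one end of the extra edge covers that edge; this end may
    -- coincide with `x₁`.
    C : Subset (order linked)
    C = ⁅ x₁ ⁆ ∪ ⁅ x₂ ⁆ ∪ ⁅ p₁ ⁆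

    C-cover : IsVertexCover linked C
    C-cover u v u∉ v∉ =
      uncovered (splitAt (suc n) u) (splitAt (suc n) v)
        (join-splitAt (suc n) (suc n) u) (join-splitAt (suc n) (suc n) v)
      where
      x₁∈ : ∀ {w} → x₁ ≡ w → w ∈ C
      x₁∈ refl = x∈p∪q⁺ (inj₁ (x∈⁅x⁆ x₁))
      x₂∈ : ∀ {w} → x₂ ≡ w → w ∈ C
      x₂∈ refl = x∈p∪q⁺ {p = ⁅ x₁ ⁆} (inj₂ (x∈p∪q⁺ (inj₁ (x∈⁅x⁆ x₂))))
      p₁∈ : ∀ {w} → p₁ ≡ w → w ∈ C
      p₁∈ refl = x∈p∪q⁺ {p = ⁅ x₁ ⁆} (inj₂ (x∈p∪q⁺ {p = ⁅ x₂ ⁆} (inj₂ (x∈⁅x⁆ p₁))))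

      uncovered : ∀ x y → vertex x ≡ u → vertex y ≡ v → ¬ Link x y
      uncovered (inj₁ zero)    (inj₁ (suc _)) e _ _ = u∉ (x₁∈ e)
      uncovered (inj₁ (suc _)) (inj₁ zero)    _ e _ = v∉ (x₁∈ e)
      uncovered (inj₂ zero)    (inj₂ (suc _)) e _ _ = u∉ (x₂∈ e)
      uncovered (inj₂ (suc _)) (inj₂ zero)    _ e _ = v∉ (x₂∈ e)
      uncovered (inj₁ _)       (inj₂ _)       e _ (refl , _) = u∉ (p₁∈ e)
      uncovered (inj₂ _)       (inj₁ _)       _ e (_ , refl) = v∉ (p₁∈ e)

  vc≤3 : vc linked ≤ 3
  vc≤3 = begin
    vc linked
      ≤⟨ proj₂ (proj₂ (vc-minimum linked)) C C-cover ⟩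
    ∣ C ∣
      ≤⟨ ∣p∪q∣≤∣p∣+∣q∣ ⁅ x₁ ⁆ (⁅ x₂ ⁆ ∪ ⁅ p₁ ⁆) ⟩
    ∣ ⁅ x₁ ⁆ ∣ + ∣ ⁅ x₂ ⁆ ∪ ⁅ p₁ ⁆ ∣
      ≤⟨ ℕ.+-monoʳ-≤ ∣ ⁅ x₁ ⁆ ∣ (∣p∪q∣≤∣p∣+∣q∣ ⁅ x₂ ⁆ ⁅ p₁ ⁆) ⟩
    ∣ ⁅ x₁ ⁆ ∣ + (∣ ⁅ x₂ ⁆ ∣ + ∣ ⁅ p₁ ⁆ ∣)
      ≤⟨ ℕ.+-mono-≤ (one x₁) (ℕ.+-mono-≤ (one x₂) (one p₁)) ⟩
    3 ∎
    where
    open ℕ.≤-Reasoning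
    one : ∀ x → ∣ ⁅ x ⁆ ∣ ≤ 1
    one x = ℕ.≤-reflexive (∣⁅x⁆∣≡1 x)

  module _ (S : Subset (order linked)) (ivcS : IsIndependentVertexCover linked S) where

    private
      one-in : ∀ {x y} → Link x y → vertex x ∉ S → vertex y ∈ S
      one-in {x} {y} a x∉ with vertex y ∈? S
      ... | yes y∈ = y∈
      ... | no  y∉ = contradiction (vertex-adj {x} {y} a) (proj₂ ivcS _ _ x∉ y∉)

      one-out : ∀ {x y} → Link x y → vertex x ∈ S → vertex y ∉ S
      one-out {x} {y} a x∈ y∈ = proj₁ ivcS _ _ x∈ y∈ (vertex-adj {x} {y} a)

    -- The two copies of p are adjacent, so exactly one of them is in S; hence
    -- the same holds for the two centres.
    not-both-centres : ∀ q → q ≡ p → x₁ ∈ S → x₂ ∉ S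
    not-both-centres zero    eq x₁∈ x₂∈ = one-out {inj₁ zero} {inj₂ zero} (eq , eq) x₁∈ x₂∈
    not-both-centres (suc i) eq x₁∈ x₂∈ = one-out {inj₂ zero} {inj₂ (suc i)} tt x₂∈
      (one-in {inj₁ (suc i)} {inj₂ (suc i)} (eq , eq)
        (one-out {inj₁ zero} {inj₁ (suc i)} tt x₁∈))

    -- Some centre lies outside `S`, and then its `n` leaves must all lie in `S`.
    n≤∣S∣ : n ≤ ∣ S ∣
    n≤∣S∣ with x₁ ∈? S
    ... | no  x₁∉ = injection⇒≤∣p∣ S (λ i → vertex (inj₁ (suc i)))
      (suc-injective ∘ inj₁-injective ∘ vertex-injective)
      λ i → one-in {inj₁ zero} {inj₁ (suc i)} tt x₁∉
    ... | yes x₁∈ = injection⇒≤∣p∣ S (λ i → vertex (inj₂ (suc i)))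
      (suc-injective ∘ inj₂-injective ∘ vertex-injective)
      λ i → one-in {inj₂ zero} {inj₂ (suc i)} tt (not-both-centres p refl x₁∈)

  n≤ivc : n ≤ ivc B
  n≤ivc with ivc-minimum B
  ... | _ , (S , ivcS , refl) , _ = n≤∣S∣ S ivcS

-- Two stars joined at leaves

module LeafLinked (m : ℕ) where

  open Linked (star (suc m)) (suc zero)

  IsCentre : Pred (Vertex (star (suc m)) ⊎ Vertex (star (suc m))) 0ℓ
  IsCentre x = x ≡ inj₁ zero ⊎ x ≡ inj₂ zero

  centres-nonadjacent : ∀ {x y} → IsCentre x → IsCentre y → ¬ Link x y
  centres-nonadjacent (inj₁ refl) (inj₁ refl) ()
  centres-nonadjacent (inj₁ refl) (inj₂ refl) (() , _)
  centres-nonadjacent (inj₂ refl) (inj₁ refl) (() , _)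
  centres-nonadjacent (inj₂ refl) (inj₂ refl) ()

  leaf₁-neighbour : ∀ {i y} → Link (inj₁ (suc i)) y → y ≡ inj₁ zero ⊎ y ≡ inj₂ (suc zero)
  leaf₁-neighbour {y = inj₁ zero} _          = inj₁ refl
  leaf₁-neighbour {y = inj₂ _}    (_ , refl) = inj₂ refl

  leaf₂-neighbour : ∀ {i y} → Link (inj₂ (suc i)) y → y ≡ inj₂ zero ⊎ y ≡ inj₁ (suc zero)
  leaf₂-neighbour {y = inj₂ zero} _          = inj₁ refl
  leaf₂-neighbour {y = inj₁ _}    (_ , refl) = inj₂ refl

  two-choices : ∀ {A : Set} {p q a b c : A} → a ≡ p ⊎ a ≡ q → b ≡ p ⊎ b ≡ q → c ≡ p ⊎ c ≡ q →
                a ≢ b → a ≢ c → b ≡ c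
  two-choices (inj₁ refl) (inj₁ refl) _           a≢b _   = contradiction refl a≢b
  two-choices (inj₁ refl) _           (inj₁ refl) _   a≢c = contradiction refl a≢c
  two-choices (inj₂ refl) (inj₂ refl) _           a≢b _   = contradiction refl a≢b
  two-choices (inj₂ refl) _           (inj₂ refl) _   a≢c = contradiction refl a≢c
  two-choices (inj₁ refl) (inj₂ refl) (inj₂ refl) _   _   = refl
  two-choices (inj₂ refl) (inj₁ refl) (inj₁ refl) _   _   = refl

  -- The only possible neighbours of a leaf are its own centre and the joined leaf of the other
  -- copy.
  degree≥3⇒centre : ∀ x {a b c} → Link x a → Link x b → Link x c →
                    a ≢ b → a ≢ c → b ≢ c → IsCentre x
  degree≥3⇒centre (inj₁ zero)    _ _ _ _ _ _ = inj₁ refl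
  degree≥3⇒centre (inj₂ zero)    _ _ _ _ _ _ = inj₂ refl
  degree≥3⇒centre (inj₁ (suc i)) {a} {b} {c} xa xb xc a≢b a≢c b≢c = contradiction
    (two-choices (leaf₁-neighbour {i} {a} xa) (leaf₁-neighbour {i} {b} xb)
                 (leaf₁-neighbour {i} {c} xc) a≢b a≢c) b≢c
  degree≥3⇒centre (inj₂ (suc i)) {a} {b} {c} xa xb xc a≢b a≢c b≢c = contradiction
    (two-choices (leaf₂-neighbour {i} {a} xa) (leaf₂-neighbour {i} {b} xb)
                 (leaf₂-neighbour {i} {c} xc) a≢b a≢c) b≢c

module _ (H : Graph) where

  -- Certifies that `x` has degree at least 3, with `y` among its neighbours. Forks in both
  -- directions give two adjacent vertices of degree at least 3.
  record Fork (x y : Vertex H) : Set where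
    field
      {a b} : Vertex H
      x-y   : Adj H x y
      x-a   : Adj H x a
      x-b   : Adj H x b
      y≢a   : y ≢ a
      y≢b   : y ≢ b
      a≢b   : a ≢ b

  -- An embedding keeps the three neighbours distinct, so `x` and `y` would both go to centres,
  -- which are not adjacent there.
  forks⋢leafLinked : ∀ {m x y} → Fork x y → Fork y x → ¬ H ↪ Linked.Link (star (suc m)) (suc zero)
  forks⋢leafLinked {m} {x} {y} fx fy (f , inj , adj) =
    centres-nonadjacent (centre fx) (centre fy) (to (adj x y) (Fork.x-y fx))
    where
    open LeafLinked m

    centre : ∀ {u v} → Fork u v → IsCentre (f u)
    centre {u} F = degree≥3⇒centre (f u) (to (adj _ _) x-y) (to (adj _ _) x-a) (to (adj _ _) x-b)
                     (y≢a ∘ inj) (y≢b ∘ inj) (a≢b ∘ inj)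
      where open Fork F

-- Two stars joined at their centres

module DoubleStar (n : ℕ) where

  open Linked (star n) zero

  private
    V : Set
    V = Vertex (star n) ⊎ Vertex (star n)

  _≟V_ : (x y : V) → Dec (x ≡ y)
  _≟V_ = ≡-dec _≟_ _≟_

  module _ {H : Graph} where

    -- Without its centre the first star leaves only isolated vertices, at most `n` of them, beside
    -- the second star.
    centre-missed : (e : H ↪ Link) → (∀ u → proj₁ e u ≢ inj₁ zero) → H ⊑ star n ⊕ n · path 1
    centre-missed e missed = ↪⇒⊑⊕ {H} (star n) (n · path 1)
      (↪-map {H = H} {R = Link} {R′ = Pointwise (Adj (star n)) (Adj (n · path 1))}
        e g P (λ u v → missed u , missed v) inj adj)
      where
      P : Rel V 0ℓ
      P x y = x ≢ inj₁ zero × y ≢ inj₁ zero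

      ι : Fin n → Vertex (n · path 1)
      ι = cast (sym (order-r·P₁ n))

      g : V → Vertex (star n) ⊎ Vertex (n · path 1)
      -- A dummy value: `P` excludes this vertex.
      g (inj₁ zero)    = inj₁ zero
      g (inj₁ (suc i)) = inj₂ (ι i)
      g (inj₂ v)       = inj₁ v

      inj : ∀ {x y} → P x y → g x ≡ g y → x ≡ y
      inj {inj₁ zero}    {_}            (x≢ , _) _  = contradiction refl x≢
      inj {_}            {inj₁ zero}    (_ , y≢) _  = contradiction refl y≢
      inj {inj₁ (suc i)} {inj₁ (suc j)} _        eq =
        cong (inj₁ ∘ suc) (cast-injective (sym (order-r·P₁ n)) (inj₂-injective eq))
      inj {inj₂ u}       {inj₂ .u}      _      refl = refl

      adj : ∀ {x y} → P x y → Link x y ⇔ Pointwise (Adj (star n)) (Adj (n · path 1)) (g x) (g y)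
      adj {inj₁ zero}    {_}            (x≢ , _) = contradiction refl x≢
      adj {inj₁ (suc _)} {inj₁ zero}    (_ , y≢) = contradiction refl y≢
      adj {inj₂ _}       {inj₁ zero}    (_ , y≢) = contradiction refl y≢
      adj {inj₁ (suc i)} {inj₁ (suc j)} _ =
        mk⇔ (λ ()) λ { (Pw.inj₂ a) → contradiction a (r·P₁-edgeless n (ι i) (ι j)) }
      adj {inj₁ (suc i)} {inj₂ v}       _ = mk⇔ (λ { (() , _) }) λ ()
      adj {inj₂ u}       {inj₁ (suc j)} _ = mk⇔ (λ { (_ , ()) }) λ ()
      adj {inj₂ u}       {inj₂ v}       _ = mk⇔ Pw.inj₁ λ { (Pw.inj₁ a) → a }

    -- The first centre becomes the subdividing vertex, the single leaf of the first copy becomes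
    -- the far end, and the second star supplies the centre with its `n` other leaves; hence
    -- `suc n`.
    one-leaf : (e : H ↪ Link) →
      (∀ u v i j → proj₁ e u ≡ inj₁ (suc i) → proj₁ e v ≡ inj₁ (suc j) → i ≡ j) →
      H ⊑ star⁺ (suc n) (s≤s z≤n)
    one-leaf e unique = ↪-map-bipartite {H = H} {R = Link} {R′ = Adj K} e g P
      (λ u v → unique u v) (λ {x} {y} → inj x y) a (λ {x} {y} → a-proper {x} {y})
      star⁺-colour star⁺-proper g-colour
      (λ {x} {y} → link-sym {x} {y}) (λ {x} {y} → symm K {x} {y})
      (λ p i j ei ej → sym (p j i ej ei)) (λ {x} {y} _ → adj x y)
      where
      K : Graph
      K = star⁺ (suc n) (s≤s z≤n)

      P : Rel V 0ℓ
      P x y = ∀ i j → x ≡ inj₁ (suc i) → y ≡ inj₁ (suc j) → i ≡ j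

      -- Negated to match `star⁺-colour`, under which the centre, here the second one, is `true`.
      a : V → Bool
      a = not ∘ colour star-colour

      a-proper : ∀ {x y} → Link x y → a x ≢ a y
      a-proper {x} {y} l =
        colour-proper {star-colour} (λ u v → star-proper {n} {u} {v}) {x} {y} l ∘ not-injective

      g : V → Vertex K
      g (inj₁ zero)    = zero
      g (inj₁ (suc _)) = suc (suc zero)
      g (inj₂ zero)    = suc zero
      g (inj₂ (suc i)) = suc (suc (suc i))

      g-colour : ∀ x → star⁺-colour (g x) ≡ a x
      g-colour (inj₁ zero)    = refl
      g-colour (inj₁ (suc _)) = refl
      g-colour (inj₂ zero)    = refl
      g-colour (inj₂ (suc _)) = refl

      inj : ∀ x y → P x y → g x ≡ g y → x ≡ y
      inj (inj₁ zero)    (inj₁ zero)    _ _    = refl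
      inj (inj₁ (suc i)) (inj₁ (suc j)) p _    = cong (inj₁ ∘ suc) (p i j refl refl)
      inj (inj₂ zero)    (inj₂ zero)    _ _    = refl
      inj (inj₂ (suc i)) (inj₂ (suc j)) _ refl = refl
      inj (inj₁ zero)    (inj₂ zero)    _ ()
      inj (inj₁ zero)    (inj₂ (suc _)) _ ()
      inj (inj₁ (suc _)) (inj₂ zero)    _ ()
      inj (inj₁ (suc _)) (inj₂ (suc _)) _ ()
      inj (inj₂ zero)    (inj₁ zero)    _ ()
      inj (inj₂ zero)    (inj₁ (suc _)) _ ()
      inj (inj₂ (suc _)) (inj₁ zero)    _ ()
      inj (inj₂ (suc _)) (inj₁ (suc _)) _ ()

      adj : ∀ x y → a x ≡ true → a y ≡ false → Link x y ⇔ Adj K (g x) (g y)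
      adj (inj₁ (suc i)) (inj₁ zero)    _ _ = mk⇔ (λ _ → inj₂ refl) (λ _ → tt)
      adj (inj₁ (suc i)) (inj₂ (suc j)) _ _ = mk⇔ (λ { (() , _) }) (λ ())
      adj (inj₂ zero)    (inj₁ zero)    _ _ = mk⇔ (λ _ → inj₁ refl) (λ _ → refl , refl)
      adj (inj₂ zero)    (inj₂ (suc j)) _ _ =
        mk⇔ (λ _ → tt , λ { (_ , inj₁ ()) ; (_ , inj₂ ()) }) (λ _ → tt)

    leaf? : (f : Vertex H → V) → U.Decidable (λ u → ∃[ i ] f u ≡ inj₁ (suc i))
    leaf? f u = any? λ i → f u ≟V inj₁ (suc i)

    -- Two vertices sent to leaves of the first copy, together with `y`, form a fork at `x`;
    -- otherwise `one-leaf` applies.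
    fork-or-one-leaf : ∀ (e : H ↪ Link) {x y} → proj₁ e x ≡ inj₁ zero → proj₁ e y ≡ inj₂ zero →
                       Fork H x y ⊎ H ⊑ star⁺ (suc n) (s≤s z≤n)
    fork-or-one-leaf e@(f , inj , adj) {x} {y} fx fy
      with any? (λ u → any? λ v → leaf? f u ×-dec leaf? f v ×-dec ¬? (u ≟ v))
    ... | yes (u , v , (i , fu) , (j , fv) , u≢v) = inj₁ record
      { x-y = from (adj x y) (subst₂ Link (sym fx) (sym fy) (refl , refl))
      ; x-a = from (adj x u) (subst₂ Link (sym fx) (sym fu) tt)
      ; x-b = from (adj x v) (subst₂ Link (sym fx) (sym fv) tt)
      ; y≢a = λ { refl → contradiction (trans (sym fy) fu) λ () }
      ; y≢b = λ { refl → contradiction (trans (sym fy) fv) λ () }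
      ; a≢b = u≢v
      }
    ... | no none = inj₂ (one-leaf e unique)
      where
      unique : ∀ u v i j → f u ≡ inj₁ (suc i) → f v ≡ inj₁ (suc j) → i ≡ j
      unique u v i j fu fv with u ≟ v
      ... | yes refl = suc-injective (inj₁-injective (trans (sym fu) fv))
      ... | no  u≢v  = contradiction (u , v , (i , fu) , (j , fv) , u≢v) none

-- As `f` need not be monotone, the sum of its values serves as the bound.
bound-upTo : (f : ℕ → ℕ) → ∀ N → ∃[ M ] (∀ k → k ≤ N → f k ≤ M)
bound-upTo f zero    = f zero , λ { zero z≤n → ℕ.≤-refl }
bound-upTo f (suc N) with bound-upTo (f ∘ suc) N
... | M , bound = f zero + M , λ { zero    _         → ℕ.m≤m+n (f zero) M
                                 ; (suc k) (s≤s k≤N) → ℕ.≤-trans (bound k k≤N) (ℕ.m≤n+m M (f zero)) }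

necessity : ∀ H → IvcBounded (FreeBipartite H) →
            Σ[ r ∈ ℕ ] Σ[ r≥1 ∈ r ≥ 1 ] (H ⊑ star r ⊕ r · path 1 ⊎ H ⊑ star⁺ r r≥1)
necessity H (f , bounded) = conclusion
  where
  M n : ℕ
  M = proj₁ (bound-upTo f 3)
  -- On linked stars `f` of `vc` is at most `M`, as `vc` is at most 3, while `ivc` is at least `n`;
  -- so no such graph is `H`-free.
  n = suc M

  embeds : ∀ p → H ↪ Linked.Link (star n) p
  embeds p with H ⊑? Linked.linked (star n) p
  ... | yes H⊑ = Linked.⊑linked⇒↪ (star n) p {H} H⊑
  ... | no free = contradiction (begin
    n               ≤⟨ n≤ivc ⟩
    ivc B           ≤⟨ bounded B free ⟩
    f (vc linked)   ≤⟨ proj₂ (bound-upTo f 3) (vc linked) vc≤3 ⟩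
    M               ∎) ℕ.1+n≰n
    where
    open ℕ.≤-Reasoning
    open LinkedStars n p

  open Linked (star n) zero
  open DoubleStar n

  e e′ : H ↪ Link
  e  = embeds zero
  -- Exchanging the copies lets the lemmas about the first centre serve for the second.
  e′ = ↪-swap {H} e

  conclusion : _
  conclusion with any? (λ u → proj₁ e u ≟V inj₁ zero) | any? (λ u → proj₁ e u ≟V inj₂ zero)
  ... | no missed | _ = n , s≤s z≤n , inj₁ (centre-missed {H} e λ u eq → missed (u , eq))
  ... | _ | no missed = n , s≤s z≤n , inj₁ (centre-missed {H} e′ λ u eq → missed (u , swap-eq eq))
    where
    swap-eq : ∀ {x} → swap x ≡ inj₁ zero → x ≡ inj₂ zero
    swap-eq {inj₂ _} refl = refl
  ... | yes (x , ex) | yes (y , ey)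
    with fork-or-one-leaf {H} e ex ey | fork-or-one-leaf {H} e′ (cong swap ey) (cong swap ex)
  ...   | inj₂ H⊑ | _       = suc n , s≤s z≤n , inj₂ H⊑
  ...   | _       | inj₂ H⊑ = suc n , s≤s z≤n , inj₂ H⊑
  -- Both centres carry forks, so `H` cannot embed into the stars joined at leaves, although
  -- `embeds` provides such an embedding.
  ...   | inj₁ fx | inj₁ fy = contradiction (embeds (suc zero)) (forks⋢leafLinked H fx fy)

theorem1 : (H : Graph) →
    IvcBounded (FreeBipartite H) ⇔
    (Σ[ r ∈ ℕ ] Σ[ r≥1 ∈ r ≥ 1 ]
      (H ⊑ star r ⊕ r · path 1 ⊎ H ⊑ star⁺ r r≥1))
theorem1 H = mk⇔ (necessity H) λ (r , r≥1 , H⊑) → sufficiency H r r≥1 H⊑
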